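{- The following are four parametric solutions, in terms of arbitrary integer parameters $s$ and $t$, of the problem of finding three integers $a, b, c$ such that $a+b+c$, $ab+bc+ca$ and $abc$ are all perfect squares; in each of them one of the three integers $a,b,c$ is a square. The first two are given by polynomials of degree 8 and the remaining two by polynomials of degree 20. (1) $a = t^2(s^2-t^2)^2(s^2+t^2)$, $b = s^2(s^2-t^2)^2(s^2+t^2)$, $c = 4s^4t^4$; (2) $a = 4s^4t^2(s^2+t^2)$, $b = 4s^2t^4(s^2+t^2)$, $c = (s^4-t^4)^2$; (3) $a = 4s^4t^2(s^2+t^2)(s^6 - s^4t^2 - 5s^2t^4 + t^6)^2$, $b = (s^4-t^4)^2(s^6 - s^4t^2 - 5s^2t^4 + t^6)^2$, $c = 4s^2t^4(s^2+t^2)(3s^6 + s^4t^2 + s^2t^4 - t^6)^2$; (4) $a = t^2(s^2-t^2)^2(s^2+t^2)(3s^6 + s^4t^2 + s^2t^4 - t^6)^2$, $b = 4s^4t^4(3s^6 + s^4t^2 + s^2t^4 - t^6)^2$, $c = s^2(s^2-t^2)^2(s^2+t^2)(s^6 - s^4t^2 - 5s^2t^4 + t^6)^2$.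
   Context: A perfect square (or square) is the square of an integer. Solution (2) is the same as a solution found by Fauquembergue in 1899. -}

module Defs where

open import Data.Fin.Base using (Fin; zero; suc)
open import Data.Integer.Base using (ℤ; +_; -_; _+_; _*_; 0ℤ; 1ℤ)
open import Data.Integer.Solver using (module +-*-Solver)
open import Data.List.Base using (List; []; _∷_; _++_; map; cartesianProductWith)
open import Data.Nat.Base as ℕ using (ℕ; zero; suc)
import Data.Nat.Properties as ℕ
open import Data.Product.Base using (_×_; _,_; ∃-syntax)
open import Data.Sum.Base using (_⊎_)
open import Data.Vec.Base as Vec using (Vec; []; _∷_)
open import Data.Vec.Properties using (≡-dec)
open import Relation.Binary.PropositionalEquality.Core using (_≡_; _≢_)
open import Relation.Nullary.Decidable.Core using (yes; no)

open +-*-Solver public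
  using (Polynomial; op; [+]; [*]; con; var; _:+_; _:-_; _:*_; :-_; _:^_; ⟦_⟧)

IsSquare : ℤ → Set
IsSquare n = ∃[ k ] n ≡ k * k

-- `Polynomial n` is a type of expressions, so coefficients and degree are read
-- off the expanded form: a list of terms c·x₀^e₀⋯xₙ₋₁^eₙ₋₁, represented as
-- (c , e), in which the same monomial may occur several times.

Term : ℕ → Set
Term n = ℤ × Vec ℕ n

infixl 7 _*ᵗ_

_*ᵗ_ : ∀ {n} → Term n → Term n → Term n
(c , e) *ᵗ (d , f) = c * d , Vec.zipWith ℕ._+_ e f

unitExponent : ∀ {n} → Fin n → Vec ℕ n
unitExponent zero    = 1 ∷ Vec.replicate _ 0
unitExponent (suc i) = 0 ∷ unitExponent i

powerTerms : ∀ {n} → List (Term n) → ℕ → List (Term n)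
powerTerms ts zero    = (1ℤ , Vec.replicate _ 0) ∷ []
powerTerms ts (suc k) = cartesianProductWith _*ᵗ_ ts (powerTerms ts k)

expand : ∀ {n} → Polynomial n → List (Term n)
expand (op [+] p q) = expand p ++ expand q
expand (op [*] p q) = cartesianProductWith _*ᵗ_ (expand p) (expand q)
expand (con c)      = (c , Vec.replicate _ 0) ∷ []
expand (var i)      = (1ℤ , unitExponent i) ∷ []
expand (p :^ k)     = powerTerms (expand p) k
expand (:- p)       = map (λ (c , e) → - c , e) (expand p)

collect : ∀ {n} → List (Term n) → Vec ℕ n → ℤ
collect []             e = 0ℤ
collect ((c , f) ∷ ts) e with ≡-dec ℕ._≟_ f e
... | yes _ = c + collect ts e
... | no  _ = collect ts e

coefficient : ∀ {n} → Polynomial n → Vec ℕ n → ℤ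
coefficient p = collect (expand p)

-- Total degree; the zero polynomial has none.
HasDegree : ∀ {n} → Polynomial n → ℕ → Set
HasDegree p d =
  (∀ e → coefficient p e ≢ 0ℤ → Vec.sum e ℕ.≤ d) ×
  (∃[ e ] Vec.sum e ≡ d × coefficient p e ≢ 0ℤ)

IsSolution : ℤ → ℤ → ℤ → Set
IsSolution a b c =
  IsSquare (a + b + c) × IsSquare (a * b + b * c + c * a) × IsSquare (a * b * c)

-- Which of a, b, c is a square may not depend on the parameters.
record IsParametricSolution (d : ℕ) (a b c : Polynomial 2) : Set where
  field
    degree-a      : HasDegree a d
    degree-b      : HasDegree b d
    degree-c      : HasDegree c d
    solution      : (s t : ℤ) → let ρ = s ∷ t ∷ [] in
                    IsSolution (⟦ a ⟧ ρ) (⟦ b ⟧ ρ) (⟦ c ⟧ ρ)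
    one-is-square : ((s t : ℤ) → IsSquare (⟦ a ⟧ (s ∷ t ∷ []))) ⊎
                    ((s t : ℤ) → IsSquare (⟦ b ⟧ (s ∷ t ∷ []))) ⊎
                    ((s t : ℤ) → IsSquare (⟦ c ⟧ (s ∷ t ∷ [])))

s t : Polynomial 2
s = var zero
t = var (suc zero)

F G : Polynomial 2
F = s :^ 6 :- s :^ 4 :* t :^ 2 :- con (+ 5) :* s :^ 2 :* t :^ 4 :+ t :^ 6
G = con (+ 3) :* s :^ 6 :+ s :^ 4 :* t :^ 2 :+ s :^ 2 :* t :^ 4 :- t :^ 6

{-# OPTIONS --safe #-}

-- F and G are even in s and t. In x = s² and y = t² set
--   u = x + y,  v = x - y,  R = x³ + 3x²y - xy² + y³,
-- so that the first two solutions satisfy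
--   y v² u + 4x²y² = y R  and  4x²y u + u²v² = u R.
-- The polynomials F and G solve both quadratic equations
--   R F² + 4xy² G² = u K²  and  x u v² F² + y R G² = L²,
-- from which all the square roots for the last two solutions are read off.

module Submission where

open import Defs
open import Data.Integer.Base using (+_; 0ℤ)
import Data.Integer.Properties as ℤ
open import Data.Integer.Solver using (module +-*-Solver)
open import Data.List.Base using (List; []; _∷_)
open import Data.List.Relation.Unary.All using (All; []; _∷_; all?)
open import Data.Nat.Base as ℕ using (ℕ)
import Data.Nat.Properties as ℕ
open import Data.Product.Base using (_×_; _,_)
open import Data.Sum.Base as Sum using (_⊎_; inj₁; inj₂)
open import Data.Vec.Base as Vec using (Vec; []; _∷_)
open import Data.Vec.Properties using (≡-dec)
open import Relation.Binary.PropositionalEquality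
  using (_≡_; _≢_; refl; cong)
open import Relation.Nullary.Decidable using (Dec; True; toWitness; yes; no; ¬?; _×-dec_)
open import Relation.Nullary.Negation using (contradiction)

open +-*-Solver using (normalise; ⟦_⟧N; prove)

TermDegree≤ : ∀ {n} → ℕ → Term n → Set
TermDegree≤ d (_ , e) = Vec.sum e ℕ.≤ d

-- A nonzero collected coefficient needs at least one listed term with exponent exactly `e`.
-- Cancellation between repeated monomials never raises the degree.
collect-degree : ∀ {n d} {ts : List (Term n)} → All (TermDegree≤ d) ts →
                 ∀ e → collect ts e ≢ 0ℤ → Vec.sum e ℕ.≤ d
collect-degree []                              e c≢0 = contradiction refl c≢0
collect-degree {ts = (_ , f) ∷ _} (f≤d ∷ ts≤d) e c≢0 with ≡-dec ℕ._≟_ f e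
... | yes refl = f≤d
... | no  _    = collect-degree ts≤d e c≢0

-- A finite, decidable certificate for `HasDegree`, whose bound ranges over infinitely many `e`: the
-- terms are bounded before cancellation.
WitnessesDegree : ∀ {n} → ℕ → Polynomial n → Vec ℕ n → Set
WitnessesDegree d p e =
  All (TermDegree≤ d) (expand p) × Vec.sum e ≡ d × coefficient p e ≢ 0ℤ

witnessesDegree? : ∀ {n} d (p : Polynomial n) e → Dec (WitnessesDegree d p e)
witnessesDegree? d p e =
  all? (λ (_ , f) → Vec.sum f ℕ.≤? d) (expand p) ×-dec
  (Vec.sum e ℕ.≟ d) ×-dec ¬? (coefficient p e ℤ.≟ 0ℤ)

witnessesDegree⇒HasDegree : ∀ {n d} {p : Polynomial n} {e} →
                            WitnessesDegree d p e → HasDegree p d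
witnessesDegree⇒HasDegree (terms≤d , attained) =
  collect-degree terms≤d , _ , attained

infix 4 _≋_²

-- Normal forms are compared without an environment, so for concrete polynomials `refl` settles the
-- identity for all parameter values at once.
_≋_² : ∀ {n} → Polynomial n → Polynomial n → Set
p ≋ q ² = normalise p ≡ normalise (q :* q)

≋²⇒IsSquare : ∀ {n} {p : Polynomial n} (q : Polynomial n) → p ≋ q ² →
              ∀ ρ → IsSquare (⟦ p ⟧ ρ)
≋²⇒IsSquare {p = p} q p≋q² ρ =
  ⟦ q ⟧ ρ , prove ρ p (q :* q) (cong (λ n → ⟦ n ⟧N ρ) p≋q²)

parametricSolution : ∀ {d a b c} (eᵃ eᵇ eᶜ : Vec ℕ 2) →
  {True (witnessesDegree? d a eᵃ)} →
  {True (witnessesDegree? d b eᵇ)} →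
  {True (witnessesDegree? d c eᶜ)} →
  (p q r w : Polynomial 2) →
  a :+ b :+ c ≋ p ² →
  a :* b :+ b :* c :+ c :* a ≋ q ² →
  a :* b :* c ≋ r ² →
  a ≋ w ² ⊎ b ≋ w ² ⊎ c ≋ w ² →
  IsParametricSolution d a b c
parametricSolution {d} {a} {b} {c} _ _ _ {degᵃ} {degᵇ} {degᶜ} p q r w p² q² r² w² = record
  { degree-a      = witnessesDegree⇒HasDegree {p = a} (toWitness degᵃ)
  ; degree-b      = witnessesDegree⇒HasDegree {p = b} (toWitness degᵇ)
  ; degree-c      = witnessesDegree⇒HasDegree {p = c} (toWitness degᶜ)
  ; solution      = λ _ _ →
        ≋²⇒IsSquare {p = a :+ b :+ c} p p² _
      , ≋²⇒IsSquare {p = a :* b :+ b :* c :+ c :* a} q q² _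
      , ≋²⇒IsSquare {p = a :* b :* c} r r² _
  ; one-is-square = Sum.map (square a) (Sum.map (square b) (square c)) w²
  }
  where
  square : ∀ f → f ≋ w ² → ∀ x y → IsSquare (⟦ f ⟧ (x ∷ y ∷ []))
  square f f≋w² _ _ = ≋²⇒IsSquare {p = f} w f≋w² _

u v K L : Polynomial 2
u = s :^ 2 :+ t :^ 2
v = s :^ 2 :- t :^ 2
K = s :^ 8 :+ con (+ 10) :* s :^ 4 :* t :^ 4 :- con (+ 4) :* s :^ 2 :* t :^ 6 :+ t :^ 8
L = s :^ 10 :+ con (+ 3) :* s :^ 8 :* t :^ 2 :+ con (+ 8) :* s :^ 6 :* t :^ 4
    :- con (+ 4) :* s :^ 4 :* t :^ 6 :- s :^ 2 :* t :^ 8 :+ t :^ 10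

mainTheorem2 : IsParametricSolution 8
    (t :^ 2 :* (s :^ 2 :- t :^ 2) :^ 2 :* (s :^ 2 :+ t :^ 2))
    (s :^ 2 :* (s :^ 2 :- t :^ 2) :^ 2 :* (s :^ 2 :+ t :^ 2))
    (con (+ 4) :* s :^ 4 :* t :^ 4)
    ×
    IsParametricSolution 8
    (con (+ 4) :* s :^ 4 :* t :^ 2 :* (s :^ 2 :+ t :^ 2))
    (con (+ 4) :* s :^ 2 :* t :^ 4 :* (s :^ 2 :+ t :^ 2))
    ((s :^ 4 :- t :^ 4) :^ 2)
    ×
    IsParametricSolution 20
    (con (+ 4) :* s :^ 4 :* t :^ 2 :* (s :^ 2 :+ t :^ 2) :* F :^ 2)
    ((s :^ 4 :- t :^ 4) :^ 2 :* F :^ 2)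
    (con (+ 4) :* s :^ 2 :* t :^ 4 :* (s :^ 2 :+ t :^ 2) :* G :^ 2)
    ×
    IsParametricSolution 20
    (t :^ 2 :* (s :^ 2 :- t :^ 2) :^ 2 :* (s :^ 2 :+ t :^ 2) :* G :^ 2)
    (con (+ 4) :* s :^ 4 :* t :^ 4 :* G :^ 2)
    (s :^ 2 :* (s :^ 2 :- t :^ 2) :^ 2 :* (s :^ 2 :+ t :^ 2) :* F :^ 2)
mainTheorem2 =
    -- The exponents, here and below, belong to the monomials with the highest power of `s`.
    parametricSolution (6 ∷ 2 ∷ []) (8 ∷ 0 ∷ []) (4 ∷ 4 ∷ [])
      -- Since a + b = u²v², the roots come from u²v² + 4x²y² = (x² + y²)² and v² + 4xy = u².
      (s :^ 4 :+ t :^ 4)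
      (s :* t :* v :* u :^ 2)
      (con (+ 2) :* s :^ 3 :* t :^ 3 :* v :^ 2 :* u)
      (con (+ 2) :* s :^ 2 :* t :^ 2)
      refl refl refl (inj₂ (inj₂ refl))
  , parametricSolution (6 ∷ 2 ∷ []) (4 ∷ 4 ∷ []) (8 ∷ 0 ∷ [])
      -- Now a + b = 4xyu² and c = u²v²; the same two identities apply in the opposite order.
      (u :^ 2)
      (con (+ 2) :* s :* t :* u :* (s :^ 4 :+ t :^ 4))
      (con (+ 4) :* s :^ 3 :* t :^ 3 :* u :^ 2 :* v)
      (u :* v)
      refl refl refl (inj₂ (inj₂ refl))
  , parametricSolution (18 ∷ 2 ∷ []) (20 ∷ 0 ∷ []) (16 ∷ 4 ∷ [])
      -- This is the second solution with its first and third members scaled by F² and its second by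
      -- G². Then a + b = uRF², so the sum is u(RF² + 4xy²G²) = u²K², and ab + c(a + b) = 4xyu²F²L².
      (u :* K)
      (con (+ 2) :* s :* t :* u :* F :* L)
      (con (+ 4) :* s :^ 3 :* t :^ 3 :* u :^ 2 :* v :* F :^ 2 :* G)
      (u :* v :* F)
      refl refl refl (inj₂ (inj₁ refl))
  , parametricSolution (18 ∷ 2 ∷ []) (16 ∷ 4 ∷ []) (20 ∷ 0 ∷ [])
      -- The first solution is scaled by G² in its first and third members and by F² in its second.
      -- Now a + b = yRG², and the two quadratic equations exchange roles: L is the root of the sum,
      -- and K enters the root of ab + c(a + b).
      L
      (s :* t :* v :* u :* G :* K)
      (con (+ 2) :* s :^ 3 :* t :^ 3 :* v :^ 2 :* u :* F :* G :^ 2)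
      (con (+ 2) :* s :^ 2 :* t :^ 2 :* G)
      refl refl refl (inj₂ (inj₁ refl))
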